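{- For every real number $M>0$ and every $\epsilon\in(0,1)$ there exists a finite transitive permutation group $G\leqslant\mathrm{Sym}(\Omega)$ which does not admit a product decomposition, such that $\rho(G,\Omega)>M$ and $(1-\epsilon)\sqrt{|\Omega|}<\rho(G,\Omega)<\sqrt{|\Omega|}$.
   Context: Let $G\leqslant\mathrm{Sym}(\Omega)$ be a finite transitive permutation group. Elements $x,y\in G$ intersect if some $\alpha\in\Omega$ satisfies $\alpha^{xy^{ -1}}=\alpha$; a subset $S\subseteq G$ is an intersecting set if every two elements of $S$ intersect; it is maximum if it has the largest possible size among intersecting sets. $\rho(G,\Omega)$ denotes $|S|/|G_\omega|$ where $S$ is a maximum intersecting set and $G_\omega$ is a point stabilizer. A permutation group $G\leqslant\mathrm{Sym}(\Omega)$ admits a product decomposition if there are permutation groups $H\leqslant\mathrm{Sym}(\Delta)$ and $K\leqslant\mathrm{Sym}(\Theta)$ with $|\Delta|\ge 2$, $|\Theta|\geq 2$, such that $G$ is permutation equivalent to the wreath product $H\wr K$ in its product action on $\Delta^{\Theta}$ (the set of functions $\Theta\to\Delta$). -}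

module Defs where

open import Data.Nat as ℕ using (ℕ; suc; _≤_; NonZero)
open import Data.Fin using (Fin; zero)
open import Data.Fin.Properties using (_≟_)
open import Data.Vec using (Vec; lookup; tabulate)
open import Data.List using (List; length; filter)
open import Data.List.Membership.Propositional using (_∈_)
open import Data.List.Relation.Unary.All using (All)
import Data.Vec.Relation.Unary.All as VAll
open import Data.List.Relation.Unary.Unique.Propositional using (Unique)
open import Data.List.Relation.Binary.Sublist.Propositional using (_⊆_)
open import Data.Product using (Σ; ∃; ∃-syntax; _×_)
open import Data.Integer using (+_)
open import Data.Rational as ℚ using (ℚ; _/_)
open import Function using (id)
open import Function.Bundles using (Inverse)
open import Relation.Binary.PropositionalEquality using (_≡_; setoid)
open import Relation.Nullary using (¬_)

-- A permutation of Ω = Fin n is represented by its table t : α ↦ α^t = lookup t α.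
Table : ℕ → Set
Table n = Vec (Fin n) n

_^_ : ∀ {n} → Fin n → Table n → Fin n
α ^ t = lookup t α

-- a table is a permutation iff it is injective (Fin n finite)
IsPerm : ∀ {n} → Table n → Set
IsPerm {n} t = ∀ (i j : Fin n) → i ^ t ≡ j ^ t → i ≡ j

idT : ∀ {n} → Table n
idT = tabulate id

_∘T_ : ∀ {n} → Table n → Table n → Table n
x ∘T y = tabulate (λ i → (i ^ x) ^ y)

IsInv : ∀ {n} → Table n → Table n → Set
IsInv {n} y z = ∀ (i : Fin n) → (i ^ y) ^ z ≡ i

-- A finite permutation group G ≤ Sym(Fin n): a duplicate-free list of
-- permutations containing the identity and closed under products
-- (finite + closed under products ⇒ subgroup).
record PermGroup (n : ℕ) : Set where
  field
    elems  : List (Table n)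
    unique : Unique elems
    perms  : All IsPerm elems
    hasId  : idT ∈ elems
    closed : ∀ {x y} → x ∈ elems → y ∈ elems → (x ∘T y) ∈ elems
open PermGroup public

Transitive : ∀ {n} → PermGroup n → Set
Transitive {n} G = ∀ (α β : Fin n) → ∃[ g ] (g ∈ elems G × α ^ g ≡ β)

stab : ∀ {n} → PermGroup n → Fin n → List (Table n)
stab G ω = filter (λ g → (ω ^ g) ≟ ω) (elems G)

Intersect : ∀ {n} → Table n → Table n → Set
Intersect {n} x y = ∃[ z ] (IsInv y z × ∃[ α ] (α ^ (x ∘T z) ≡ α))

IntersectingSet : ∀ {n} → List (Table n) → Set
IntersectingSet S = ∀ {x y} → x ∈ S → y ∈ S → Intersect x y

-- S is a maximum intersecting set of G (subsets of G = sublists of its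
-- duplicate-free element list)
MaxIntersecting : ∀ {n} → PermGroup n → List (Table n) → Set
MaxIntersecting G S =
  (S ⊆ elems G) × IntersectingSet S ×
  (∀ S′ → S′ ⊆ elems G → IntersectingSet S′ → length S′ ≤ length S)

ratio : (s g : ℕ) → .{{NonZero g}} → ℚ
ratio s g = (+ s) / g

-- Product action of the wreath product H ≀ K on Δ^Θ, Δ = Fin a, Θ = Fin b,
-- functions Θ → Δ represented as Vec (Fin a) b.
-- WrAct hs k f f′ :  f′ = f^{(hs,k)}, i.e. f′(θ^k) = f(θ)^{hs θ} for all θ.
WrAct : ∀ {a b} → Vec (Table a) b → Table b → Vec (Fin a) b → Vec (Fin a) b → Set
WrAct {a} {b} hs k f f′ = ∀ (θ : Fin b) → lookup f′ (θ ^ k) ≡ lookup f θ ^ lookup hs θ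

PermEquivWreath : ∀ {n a b} → PermGroup n → PermGroup a → PermGroup b →
                  Inverse (setoid (Fin n)) (setoid (Vec (Fin a) b)) → Set
PermEquivWreath {n} {a} {b} G H K φ =
  (∀ {g} → g ∈ elems G →
     ∃[ hs ] ∃[ k ] (VAll.All (_∈ elems H) hs × k ∈ elems K ×
       (∀ (α : Fin n) → WrAct hs k (to α) (to (α ^ g))))) ×
  (∀ (hs : Vec (Table a) b) (k : Table b) → VAll.All (_∈ elems H) hs → k ∈ elems K →
     ∃[ g ] (g ∈ elems G × (∀ (α : Fin n) → WrAct hs k (to α) (to (α ^ g)))))
  where
    open Inverse φ

AdmitsProductDecomposition : ∀ {n} → PermGroup n → Set
AdmitsProductDecomposition {n} G =
  ∃[ a ] ∃[ b ] Σ (PermGroup a) λ H → Σ (PermGroup b) λ K →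
    (2 ≤ a) × (2 ≤ b) ×
    Σ (Inverse (setoid (Fin n)) (setoid (Vec (Fin a) b))) λ φ →
      PermEquivWreath G H K φ

{-# OPTIONS --safe #-}

-- Let K be a field with q = 2^k elements and L its quadratic extension.  The
-- norm-one subgroup C of L, of order q + 1, acts regularly on the directions
-- of the affine plane L, so G = L ⋊ C acts transitively on the q (q + 1)
-- affine K-lines, with line stabilisers of order q.  Every translation fixes
-- each line in its own direction, so the q² translations are intersecting;
-- intersecting elements act alike on the directions, so no intersecting set is
-- larger.  Hence ρ = q.  A product decomposition would make the degree
-- q (q + 1) a b-th power with b ≥ 2, hence also its coprime factors q and q + 1.
module Submission where

open import Defs
open import Algebra.Bundles using (RawRing; CommutativeRing)
import Algebra.Solver.Ring
open import Algebra.Solver.Ring.AlmostCommutativeRing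
  using (AlmostCommutativeRing; _-Raw-AlmostCommutative⟶_; Induced-equivalence)
open import Algebra.Structures using (IsCommutativeSemiring)
open import Algebra.Structures.Biased using (module IsCommutativeSemiringˡ)
open import Axiom.UniquenessOfIdentityProofs using (module Decidable⇒UIP)
open import Data.Bool using (Bool; true; false; _xor_; _∧_)
import Data.Bool.Properties as Bool
open import Data.Fin using (Fin; zero; suc; punchOut)
import Data.Fin.Permutation as Permutation
open import Data.Fin.Properties
  using (_≟_; any?; injective⇒≤; punchOut-injective; *↔×; +↔⊎; 1↔⊤; 2↔Bool; ¬∀⟶∃¬)
open import Data.List using (List; []; _∷_; length; filter; map; lookup)
import Data.List as List
open import Data.List.Membership.Propositional using (_∈_)
open import Data.List.Membership.Propositional.Properties
  using (∈-lookup; ∈-map⁺; ∈-map⁻; ∈-filter⁺; ∈-filter⁻; ∈-tabulate⁺; ∈-map∘filter⁺; ∈-map∘filter⁻)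
import Data.List.Membership.Setoid.Properties as ∈ₛ
open import Data.List.Relation.Binary.Sublist.Propositional using (_⊆_; []; _∷_; _∷ʳ_)
import Data.List.Relation.Binary.Sublist.Propositional as Sublist
import Data.List.Relation.Binary.Sublist.Propositional.Properties as Sublist
import Data.List.Relation.Unary.All as All
open import Data.List.Relation.Unary.AllPairs using ([]; _∷_)
open import Data.List.Relation.Unary.Any using (here; index)
open import Data.List.Relation.Unary.Unique.Propositional using (Unique)
import Data.List.Relation.Unary.Unique.Propositional.Properties as Unique
open import Data.Maybe using (just; nothing)
open import Data.Nat as ℕ using (ℕ; zero; suc; NonZero)
open import Data.Nat.Induction using (<-rec)
import Data.Nat.Properties as ℕ
open import Data.Product using (Σ; ∃₂; ∃-syntax; _×_; _,_; proj₁; proj₂)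
open import Data.Product.Function.NonDependent.Propositional using (_×-↔_)
open import Data.Sum using (_⊎_; inj₁; inj₂)
open import Data.Sum.Function.Propositional using (_⊎-↔_)
open import Data.Unit using (⊤; tt)
open import Data.Vec as Vec using (Vec; []; _∷_)
open import Data.Vec.Properties using (lookup∘tabulate; tabulate-cong)
open import Function using (_∘_; id)
open import Function.Bundles using (_↔_; mk↔ₛ′; Inverse; Injection)
open import Function.Properties.Inverse using (↔-refl; ↔-sym; ↔-trans; ↔⇒↣)
open import Relation.Binary.Definitions using (DecidableEquality; WeaklyDecidable)
open import Relation.Binary.PropositionalEquality
open import Relation.Nullary using (¬_; Dec; yes; no; contradiction)
open import Relation.Nullary.Decidable using (via-injection)
open import Relation.Unary using (Decidable)

-- Characteristic 2 is what makes C regular on the directions. Squaring is then a bijection of K,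
-- and N (k z) = k² N z, so each direction contains exactly one vector of norm one; in odd
-- characteristic -1 would lie in C and fix every direction.
--
-- Orders 2^k are needed only for unboundedly many k, so the fields are built by iterating one
-- quadratic extension, starting from the field of two elements.
--
-- As ρ² / |Ω| = q / (q + 1), both M and ε merely ask that q be large, and the square root is
-- handled by comparing squares. The final contradiction, q = x^b and q + 1 = c^b, is elementary:
-- positive b-th powers with b ≥ 2 are never consecutive.

↔-injective : ∀ {a b} {A : Set a} {B : Set b} (e : A ↔ B) {x y : A} →
  Inverse.to e x ≡ Inverse.to e y → x ≡ y
↔-injective e = Injection.injective (↔⇒↣ e)

-- A missed value `j` could be punched out of the codomain, leaving an injection of a finite set
-- into one with a point fewer.
finite-injective⇒surjective : ∀ {n} (f : Fin n → Fin n) →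
  (∀ {i j} → f i ≡ f j → i ≡ j) → ∀ j → ∃[ i ] f i ≡ j
finite-injective⇒surjective {suc n} f inj j with any? (λ i → f i ≟ j)
... | yes hit  = hit
... | no  miss = contradiction (injective⇒≤ squeezed-injective) ℕ.1+n≰n
  where
  j≢f : ∀ i → j ≢ f i
  j≢f i eq = miss (i , sym eq)

  squeezed-injective : ∀ {i k} → punchOut (j≢f i) ≡ punchOut (j≢f k) → i ≡ k
  squeezed-injective eq = inj (punchOut-injective (j≢f _) (j≢f _) eq)

-- Finite fields of characteristic 2.

record BinaryField : Set₁ where
  infixl 6 _⊕_
  infixl 7 _·_
  infix  8 _⁻¹
  field
    Carrier               : Set
    _⊕_ _·_               : Carrier → Carrier → Carrier
    𝟘 𝟙                   : Carrier
    _⁻¹                   : Carrier → Carrier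
    isCommutativeSemiring : IsCommutativeSemiring _≡_ _⊕_ _·_ 𝟘 𝟙
    ⊕-self                : ∀ x → x ⊕ x ≡ 𝟘
    𝟘≢𝟙                   : 𝟘 ≢ 𝟙
    ⁻¹-inverse            : ∀ {x} → x ≢ 𝟘 → x · x ⁻¹ ≡ 𝟙
    -- Storing q - 1 makes the order a successor by definition, so that the degree (q + 1) q reduces
    -- to the form `suc m`.
    order-1               : ℕ
    enum                  : Carrier ↔ Fin (suc order-1)

  order : ℕ
  order = suc order-1

𝔽₂ : BinaryField
𝔽₂ = record
  { Carrier = Bool ; _⊕_ = _xor_ ; _·_ = _∧_ ; 𝟘 = false ; 𝟙 = true ; _⁻¹ = id
  ; isCommutativeSemiring = R.isCommutativeSemiring
  ; ⊕-self = Bool.xor-same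
  ; 𝟘≢𝟙 = λ ()
  ; ⁻¹-inverse = λ { {false} 0≢0 → contradiction refl 0≢0 ; {true} _ → refl }
  ; order-1 = 1
  ; enum = ↔-sym 2↔Bool
  }
  where module R = CommutativeRing Bool.xor-∧-commutativeRing

module FieldProperties (F : BinaryField) where
  open BinaryField F public
  private module S = IsCommutativeSemiring isCommutativeSemiring
  open S public using () renaming
    ( +-identityʳ to ⊕-identityʳ; +-comm to ⊕-comm; +-assoc to ⊕-assoc
    ; *-identityʳ to ·-identityʳ
    ; zeroʳ to ·-zeroʳ; zeroˡ to ·-zeroˡ; *-comm to ·-comm)

  -- Coefficients in Bool make the solver decide identities modulo 2, and
  -- negation is the identity.
  private
    coefficients : RawRing _ _
    coefficients = record
      { Carrier = Bool ; _≈_ = _≡_ ; _+_ = _xor_ ; _*_ = _∧_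
      ; -_ = id ; 0# = false ; 1# = true }

    almostRing : AlmostCommutativeRing _ _
    almostRing = record
      { Carrier = Carrier ; _≈_ = _≡_ ; _+_ = _⊕_ ; _*_ = _·_
      ; -_ = id ; 0# = 𝟘 ; 1# = 𝟙
      ; isAlmostCommutativeRing = record
        { isCommutativeSemiring = isCommutativeSemiring
        ; -‿cong = id ; -‿*-distribˡ = λ _ _ → refl ; -‿+-comm = λ _ _ → refl } }

    coefficients→K : coefficients -Raw-AlmostCommutative⟶ almostRing
    coefficients→K = record
      { ⟦_⟧ = λ { false → 𝟘 ; true → 𝟙 }
      ; +-homo = λ { false b → sym (S.+-identityˡ _)
                   ; true false → sym (S.+-identityʳ _)
                   ; true true → sym (⊕-self _) }
      ; *-homo = λ { false b → sym (S.zeroˡ _) ; true b → sym (S.*-identityˡ _) }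
      ; -‿homo = λ _ → refl ; 0-homo = refl ; 1-homo = refl }

    _coeff≟_ : WeaklyDecidable (Induced-equivalence coefficients→K)
    false coeff≟ false = just refl
    true  coeff≟ true  = just refl
    _     coeff≟ _     = nothing

  module Solver = Algebra.Solver.Ring coefficients almostRing coefficients→K _coeff≟_

  open Solver using (solve; con; _:=_; _:+_; _:*_)
  open ≡-Reasoning
  private module E = Inverse enum

  infix 4 _≟K_
  _≟K_ : DecidableEquality Carrier
  _≟K_ = via-injection (↔⇒↣ enum) _≟_

  abstract
    injective⇒surjective : ∀ (f : Carrier → Carrier) →
      (∀ {x y} → f x ≡ f y → x ≡ y) → ∀ y → ∃[ x ] f x ≡ y
    injective⇒surjective f inj y
      with i , eq ← finite-injective⇒surjective (E.to ∘ f ∘ E.from)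
                      (↔-injective (↔-sym enum) ∘ inj ∘ ↔-injective enum) (E.to y)
      = E.from i , ↔-injective enum eq

  ⊕≡𝟘⇒≡ : ∀ {x y} → x ⊕ y ≡ 𝟘 → x ≡ y
  ⊕≡𝟘⇒≡ {x} {y} eq = begin
    x            ≡⟨ solve 2 (λ x y → x := (x :+ y) :+ y) refl x y ⟩
    x ⊕ y ⊕ y    ≡⟨ cong (_⊕ y) eq ⟩
    𝟘 ⊕ y        ≡⟨ S.+-identityˡ y ⟩
    y            ∎

  ·-cancel-𝟘 : ∀ {x y} → x ≢ 𝟘 → x · y ≡ 𝟘 → y ≡ 𝟘
  ·-cancel-𝟘 {x} {y} x≢0 eq = begin
    y                  ≡⟨ S.*-identityˡ y ⟨
    𝟙 · y              ≡⟨ cong (_· y) (⁻¹-inverse x≢0) ⟨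
    x · x ⁻¹ · y       ≡⟨ solve 3 (λ x i y → x :* i :* y := i :* (x :* y)) refl x (x ⁻¹) y ⟩
    x ⁻¹ · (x · y)     ≡⟨ cong (x ⁻¹ ·_) eq ⟩
    x ⁻¹ · 𝟘           ≡⟨ S.zeroʳ _ ⟩
    𝟘                  ∎

  square≡𝟘⇒≡𝟘 : ∀ {x} → x · x ≡ 𝟘 → x ≡ 𝟘
  square≡𝟘⇒≡𝟘 {x} eq with x ≟K 𝟘
  ... | yes x≡0 = x≡0
  ... | no  x≢0 = ·-cancel-𝟘 x≢0 eq

  -- Squaring is additive in characteristic 2, so equal squares have a difference whose square is
  -- `𝟘`.
  square-injective : ∀ {x y} → x · x ≡ y · y → x ≡ y
  square-injective {x} {y} eq = ⊕≡𝟘⇒≡ (square≡𝟘⇒≡𝟘 (begin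
    (x ⊕ y) · (x ⊕ y)  ≡⟨ solve 2 (λ x y → (x :+ y) :* (x :+ y) := x :* x :+ y :* y) refl x y ⟩
    x · x ⊕ y · y      ≡⟨ cong (_⊕ y · y) eq ⟩
    y · y ⊕ y · y      ≡⟨ ⊕-self _ ⟩
    𝟘                  ∎))

  √ : Carrier → Carrier
  √ x = proj₁ (injective⇒surjective (λ y → y · y) square-injective x)

  √-square : ∀ x → √ x · √ x ≡ x
  √-square x = proj₂ (injective⇒surjective (λ y → y · y) square-injective x)

  -- The Artin-Schreier map: X² + X + c has a root exactly when c is one of its values.
  ℘ : Carrier → Carrier
  ℘ y = y · y ⊕ y

  -- ℘ takes the value 𝟘 at both 𝟘 and 𝟙, so by finiteness it misses some value.
  ℘-no-section : (section : Carrier → Carrier) → ¬ (∀ x → ℘ (section x) ≡ x)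
  ℘-no-section section ℘-section =
    𝟘≢𝟙 (trans (sym (section-℘ 𝟘)) (trans (cong section ℘𝟘≡℘𝟙) (section-℘ 𝟙)))
    where
    section-injective : ∀ {x y} → section x ≡ section y → x ≡ y
    section-injective eq = trans (sym (℘-section _)) (trans (cong ℘ eq) (℘-section _))
    section-℘ : ∀ x → section (℘ x) ≡ x
    section-℘ x with z , refl ← injective⇒surjective section section-injective x
      = cong section (℘-section z)
    ℘𝟘≡℘𝟙 : ℘ 𝟘 ≡ ℘ 𝟙
    ℘𝟘≡℘𝟙 = solve 0 (con false :* con false :+ con false := con true :* con true :+ con true) refl

  abstract
    -- Membership in the image is decided by search. If every value were hit, the preimages found
    -- would form a section, which `℘-no-section` excludes. The missed value makes X² + X + c
    -- irreducible.
    ℘-not-surjective : ∃[ c ] ∀ y → ℘ y ≢ c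
    ℘-not-surjective
      with i , miss ← ¬∀⟶∃¬ order (λ i → ∃[ j ] ℘ (E.from j) ≡ E.from i)
             (λ i → any? λ j → ℘ (E.from j) ≟K E.from i)
             (λ hits → ℘-no-section (λ x → E.from (proj₁ (hits (E.to x))))
               λ x → trans (proj₂ (hits (E.to x))) (E.strictlyInverseʳ x))
      = E.from i , λ y eq → miss (E.to y , trans (cong ℘ (E.strictlyInverseʳ y)) eq)

-- The quadratic extension K[α] with α² = α + c.  A pair (a , b) stands for
-- a + b α, and N (a , b) is its norm.
module QuadraticExtension (F : BinaryField) where
  open FieldProperties F public
  open Solver using (solve; con; _:=_; _:+_; _:*_)
  open ≡-Reasoning

  L : Set
  L = Carrier × Carrier

  c : Carrier
  c = proj₁ ℘-not-surjective

  infixl 6 _⊞_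
  infixl 7 _⊠_

  _⊞_ _⊠_ : L → L → L
  (a , b) ⊞ (a′ , b′) = (a ⊕ a′) , (b ⊕ b′)
  (a , b) ⊠ (a′ , b′) = (a · a′ ⊕ c · b · b′) , (a · b′ ⊕ b · a′ ⊕ b · b′)

  0L 1L : L
  0L = 𝟘 , 𝟘
  1L = 𝟙 , 𝟘

  N : L → Carrier
  N (a , b) = a · a ⊕ a · b ⊕ c · b · b

  -- The second root of X² + X + c is α + 1, so a + b α goes to (a + b) + b α.
  conj : L → L
  conj (a , b) = (a ⊕ b) , b

  scale : Carrier → L → L
  scale k (a , b) = (k · a) , (k · b)

  abstract
    ⊞-assoc : ∀ x y z → (x ⊞ y) ⊞ z ≡ x ⊞ (y ⊞ z)
    ⊞-assoc _ _ _ = cong₂ _,_ (⊕-assoc _ _ _) (⊕-assoc _ _ _)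

    ⊞-comm : ∀ x y → x ⊞ y ≡ y ⊞ x
    ⊞-comm (a , b) (a′ , b′) = cong₂ _,_ (⊕-comm a a′) (⊕-comm b b′)

    ⊞-self : ∀ x → x ⊞ x ≡ 0L
    ⊞-self (a , b) = cong₂ _,_ (⊕-self a) (⊕-self b)

    ⊞-identityʳ : ∀ x → x ⊞ 0L ≡ x
    ⊞-identityʳ (a , b) = cong₂ _,_ (⊕-identityʳ a) (⊕-identityʳ b)

    ⊠-assoc : ∀ x y z → (x ⊠ y) ⊠ z ≡ x ⊠ (y ⊠ z)
    ⊠-assoc (a , b) (a′ , b′) (a″ , b″) = cong₂ _,_
      (solve 7 (λ c a b a′ b′ a″ b″ →
          (a :* a′ :+ c :* b :* b′) :* a″ :+ c :* (a :* b′ :+ b :* a′ :+ b :* b′) :* b″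
       := a :* (a′ :* a″ :+ c :* b′ :* b″) :+ c :* b :* (a′ :* b″ :+ b′ :* a″ :+ b′ :* b″))
       refl c a b a′ b′ a″ b″)
      (solve 7 (λ c a b a′ b′ a″ b″ →
          (a :* a′ :+ c :* b :* b′) :* b″ :+ (a :* b′ :+ b :* a′ :+ b :* b′) :* a″
            :+ (a :* b′ :+ b :* a′ :+ b :* b′) :* b″
       := a :* (a′ :* b″ :+ b′ :* a″ :+ b′ :* b″) :+ b :* (a′ :* a″ :+ c :* b′ :* b″)
            :+ b :* (a′ :* b″ :+ b′ :* a″ :+ b′ :* b″))
       refl c a b a′ b′ a″ b″)

    ⊠-comm : ∀ x y → x ⊠ y ≡ y ⊠ x
    ⊠-comm (a , b) (a′ , b′) = cong₂ _,_
      (solve 5 (λ c a b a′ b′ → a :* a′ :+ c :* b :* b′ := a′ :* a :+ c :* b′ :* b) refl c a b a′ b′)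
      (solve 4 (λ a b a′ b′ → a :* b′ :+ b :* a′ :+ b :* b′ := a′ :* b :+ b′ :* a :+ b′ :* b) refl a b a′ b′)

    ⊠-identityˡ : ∀ x → 1L ⊠ x ≡ x
    ⊠-identityˡ (a , b) = cong₂ _,_
      (solve 3 (λ c a b → con true :* a :+ c :* con false :* b := a) refl c a b)
      (solve 2 (λ a b → con true :* b :+ con false :* a :+ con false :* b := b) refl a b)

    ⊠-identityʳ : ∀ x → x ⊠ 1L ≡ x
    ⊠-identityʳ x = trans (⊠-comm x 1L) (⊠-identityˡ x)

    ⊠-zeroˡ : ∀ x → 0L ⊠ x ≡ 0L
    ⊠-zeroˡ (a , b) = cong₂ _,_
      (solve 3 (λ c a b → con false :* a :+ c :* con false :* b := con false) refl c a b)
      (solve 2 (λ a b → con false :* b :+ con false :* a :+ con false :* b := con false) refl a b)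

    ⊠-distribʳ : ∀ x y z → (y ⊞ z) ⊠ x ≡ y ⊠ x ⊞ z ⊠ x
    ⊠-distribʳ (a , b) (a′ , b′) (a″ , b″) = cong₂ _,_
      (solve 7 (λ c a b a′ b′ a″ b″ →
          (a′ :+ a″) :* a :+ c :* (b′ :+ b″) :* b
       := (a′ :* a :+ c :* b′ :* b) :+ (a″ :* a :+ c :* b″ :* b))
       refl c a b a′ b′ a″ b″)
      (solve 6 (λ a b a′ b′ a″ b″ →
          (a′ :+ a″) :* b :+ (b′ :+ b″) :* a :+ (b′ :+ b″) :* b
       := (a′ :* b :+ b′ :* a :+ b′ :* b) :+ (a″ :* b :+ b″ :* a :+ b″ :* b))
       refl a b a′ b′ a″ b″)

    ⊠-distribˡ : ∀ x y z → x ⊠ (y ⊞ z) ≡ x ⊠ y ⊞ x ⊠ z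
    ⊠-distribˡ x y z = begin
      x ⊠ (y ⊞ z)    ≡⟨ ⊠-comm x _ ⟩
      (y ⊞ z) ⊠ x    ≡⟨ ⊠-distribʳ x y z ⟩
      y ⊠ x ⊞ z ⊠ x  ≡⟨ cong₂ _⊞_ (⊠-comm y x) (⊠-comm z x) ⟩
      x ⊠ y ⊞ x ⊠ z  ∎

    N-⊠ : ∀ x y → N (x ⊠ y) ≡ N x · N y
    N-⊠ (a , b) (a′ , b′) = solve 5 (λ c a b a′ b′ →
        let p = a :* a′ :+ c :* b :* b′
            q = a :* b′ :+ b :* a′ :+ b :* b′
        in p :* p :+ p :* q :+ c :* q :* q
        := (a :* a :+ a :* b :+ c :* b :* b) :* (a′ :* a′ :+ a′ :* b′ :+ c :* b′ :* b′))
      refl c a b a′ b′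

    N-conj : ∀ x → N (conj x) ≡ N x
    N-conj (a , b) = solve 3 (λ c a b →
        (a :+ b) :* (a :+ b) :+ (a :+ b) :* b :+ c :* b :* b := a :* a :+ a :* b :+ c :* b :* b)
      refl c a b

    N-scale : ∀ k x → N (scale k x) ≡ k · k · N x
    N-scale k (a , b) = solve 4 (λ c k a b →
        (k :* a) :* (k :* a) :+ (k :* a) :* (k :* b) :+ c :* (k :* b) :* (k :* b)
        := k :* k :* (a :* a :+ a :* b :+ c :* b :* b))
      refl c k a b

    N-1L : N 1L ≡ 𝟙
    N-1L = solve 1 (λ c → con true :* con true :+ con true :* con false :+ c :* con false :* con false
                       := con true) refl c

    ⊠-conj : ∀ x → x ⊠ conj x ≡ (N x , 𝟘)
    ⊠-conj (a , b) = cong₂ _,_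
      (solve 3 (λ c a b → a :* (a :+ b) :+ c :* b :* b := a :* a :+ a :* b :+ c :* b :* b) refl c a b)
      (solve 2 (λ a b → a :* b :+ b :* (a :+ b) :+ b :* b := con false) refl a b)

    scale-⊠ : ∀ k x y → scale k x ⊠ y ≡ scale k (x ⊠ y)
    scale-⊠ k (a , b) (a′ , b′) = cong₂ _,_
      (solve 6 (λ c k a b a′ b′ →
          (k :* a) :* a′ :+ c :* (k :* b) :* b′ := k :* (a :* a′ :+ c :* b :* b′)) refl c k a b a′ b′)
      (solve 5 (λ k a b a′ b′ →
          (k :* a) :* b′ :+ (k :* b) :* a′ :+ (k :* b) :* b′ := k :* (a :* b′ :+ b :* a′ :+ b :* b′)) refl k a b a′ b′)

    -- This is where the choice of `c` enters: if b ≠ 0, dividing the norm equation by b² gives ℘ (a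
    -- / b) = c.
    N≡𝟘⇒≡0L : ∀ x → N x ≡ 𝟘 → x ≡ 0L
    N≡𝟘⇒≡0L (a , b) N≡0 with b ≟K 𝟘
    ... | yes refl = cong (_, 𝟘) (square≡𝟘⇒≡𝟘 (trans
            (solve 2 (λ c a → a :* a := a :* a :+ a :* con false :+ c :* con false :* con false) refl c a)
            N≡0))
    ... | no b≢0 = contradiction ℘≡c (proj₂ ℘-not-surjective (a · b ⁻¹))
      where
      u : Carrier
      u = b ⁻¹
      ℘≡c : ℘ (a · u) ≡ c
      ℘≡c = begin
        ℘ (a · u)
          -- The solver does not know that b u = 1. The right-hand side is therefore arranged so
          -- that this relation is only needed at the visible products `b · u`, where the next step
          -- substitutes it.
          ≡⟨ solve 4 (λ c a b u → (a :* u) :* (a :* u) :+ a :* u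
               := u :* u :* (a :* a :+ a :* b :+ c :* b :* b)
                  :+ a :* u :* (b :* u :+ con true) :+ c :* (b :* u) :* (b :* u)) refl c a b u ⟩
        u · u · N (a , b) ⊕ a · u · (b · u ⊕ 𝟙) ⊕ c · (b · u) · (b · u)
          ≡⟨ cong₂ (λ n e → u · u · n ⊕ a · u · (e ⊕ 𝟙) ⊕ c · e · e) N≡0 (⁻¹-inverse b≢0) ⟩
        u · u · 𝟘 ⊕ a · u · (𝟙 ⊕ 𝟙) ⊕ c · 𝟙 · 𝟙
          ≡⟨ solve 3 (λ c a u → u :* u :* con false :+ a :* u :* (con true :+ con true)
               :+ c :* con true :* con true := c) refl c a u ⟩
        c ∎

  infix 8 _⁻¹ᴸ
  _⁻¹ᴸ : L → L
  x ⁻¹ᴸ = scale (N x ⁻¹) (conj x)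

  abstract
    ⁻¹ᴸ-inverse : ∀ {x} → x ≢ 0L → x ⊠ x ⁻¹ᴸ ≡ 1L
    ⁻¹ᴸ-inverse {x} x≢0 = begin
      x ⊠ scale n (conj x)   ≡⟨ ⊠-comm x _ ⟩
      scale n (conj x) ⊠ x   ≡⟨ scale-⊠ n (conj x) x ⟩
      scale n (conj x ⊠ x)   ≡⟨ cong (scale n) (trans (⊠-comm _ x) (⊠-conj x)) ⟩
      scale n (N x , 𝟘)      ≡⟨ cong₂ _,_ (trans (·-comm n _) (⁻¹-inverse (x≢0 ∘ N≡𝟘⇒≡0L x))) (·-zeroʳ n) ⟩
      1L                     ∎
      where
      n : Carrier
      n = N x ⁻¹

  enumL : L ↔ Fin (order ℕ.* order)
  enumL = ↔-trans (enum ×-↔ enum) (↔-sym *↔×)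

  extension : BinaryField
  extension = record
    { Carrier = L ; _⊕_ = _⊞_ ; _·_ = _⊠_ ; 𝟘 = 0L ; 𝟙 = 1L ; _⁻¹ = _⁻¹ᴸ
    ; isCommutativeSemiring = IsCommutativeSemiringˡ.isCommutativeSemiring record
      { +-isCommutativeMonoid = isCommutativeMonoid _⊞_ ⊞-assoc ⊞-comm ⊞-identityʳ
      ; *-isCommutativeMonoid = isCommutativeMonoid _⊠_ ⊠-assoc ⊠-comm ⊠-identityʳ
      ; distribʳ = ⊠-distribʳ
      ; zeroˡ = ⊠-zeroˡ }
    ; ⊕-self = ⊞-self
    ; 𝟘≢𝟙 = 𝟘≢𝟙 ∘ cong proj₁
    ; ⁻¹-inverse = ⁻¹ᴸ-inverse
    -- The successor of this number is `order ℕ.* order` by computation, as `enumL` requires.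
    ; order-1 = order-1 ℕ.+ order-1 ℕ.* order
    ; enum = enumL
    }
    where
    open import Algebra.Structures {A = L} _≡_ using (IsCommutativeMonoid)
    isCommutativeMonoid : ∀ _∙_ {ε} → (∀ x y z → (x ∙ y) ∙ z ≡ x ∙ (y ∙ z)) →
      (∀ x y → x ∙ y ≡ y ∙ x) → (∀ x → x ∙ ε ≡ x) → IsCommutativeMonoid _∙_ ε
    isCommutativeMonoid _∙_ assoc comm identityʳ = record
      { isMonoid = record
        { isSemigroup = record
          { isMagma = record { isEquivalence = isEquivalence ; ∙-cong = cong₂ _∙_ }
          ; assoc = assoc }
        ; identity = (λ x → trans (comm _ x) (identityʳ x)) , identityʳ }
      ; comm = comm }

open QuadraticExtension using (extension)

-- Each step squares the order, so the orders are 2^(2^i).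
tower : ℕ → BinaryField
tower zero    = 𝔽₂
tower (suc i) = extension (tower i)

-- Counting in duplicate-free lists.

module _ {a} {A : Set a} where

  lookup-injective : ∀ {xs : List A} → Unique xs → ∀ {i j} → lookup xs i ≡ lookup xs j → i ≡ j
  lookup-injective (x∉xs ∷ _) {zero}  {zero}  _  = refl
  lookup-injective (x∉xs ∷ _) {zero}  {suc j} eq = contradiction eq (All.lookup x∉xs (∈-lookup j))
  lookup-injective (x∉xs ∷ _) {suc i} {zero}  eq = contradiction (sym eq) (All.lookup x∉xs (∈-lookup i))
  lookup-injective (_ ∷ u)    {suc i} {suc j} eq = cong suc (lookup-injective u eq)

  Unique-⊆ : ∀ {xs ys : List A} → xs ⊆ ys → Unique ys → Unique xs
  Unique-⊆ []          []        = []
  Unique-⊆ (_ ∷ʳ p)    (_ ∷ u)   = Unique-⊆ p u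
  Unique-⊆ (refl ∷ p)  (y∉ ∷ u)  = Sublist.All-resp-⊆ p y∉ ∷ Unique-⊆ p u

  covered⇒length≤ : ∀ {k} {xs : List A} (e : Fin k → A) → Unique xs →
    (∀ {x} → x ∈ xs → ∃[ i ] e i ≡ x) → length xs ℕ.≤ k
  covered⇒length≤ {xs = xs} e u cover = injective⇒≤ {f = proj₁ ∘ cover ∘ ∈-lookup} λ {i} {j} eq →
    lookup-injective u (trans (sym (proj₂ (cover (∈-lookup i))))
      (trans (cong e eq) (proj₂ (cover (∈-lookup j)))))

  injects⇒≤length : ∀ {k} {xs : List A} (e : Fin k → A) → (∀ {i j} → e i ≡ e j → i ≡ j) →
    (∀ i → e i ∈ xs) → k ℕ.≤ length xs
  injects⇒≤length e inj e∈ = injective⇒≤ {f = index ∘ e∈} λ eq →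
    inj (∈ₛ.index-injective (setoid A) (e∈ _) (e∈ _) eq)

  length≡ : ∀ {k} {xs : List A} (e : Fin k → A) → Unique xs → (∀ {i j} → e i ≡ e j → i ≡ j) →
    (∀ i → e i ∈ xs) → (∀ {x} → x ∈ xs → ∃[ i ] e i ≡ x) → length xs ≡ k
  length≡ e u inj e∈ cover = ℕ.≤-antisym (covered⇒length≤ e u cover) (injects⇒≤length e inj e∈)

-- Permutation groups and intersecting sets from a faithful finite action.

module FaithfulAction {X A : Set} {n k} (enumX : X ↔ Fin n) (enumA : A ↔ Fin k)
  (act : X → A → X) (_∙_ : A → A → A) (ε : A) (_⁻ : A → A)
  (act-ε : ∀ x → act x ε ≡ x)
  (act-∙ : ∀ x a b → act x (a ∙ b) ≡ act (act x a) b)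
  (act-⁻ʳ : ∀ x a → act (act x a) (a ⁻) ≡ x)
  (act-⁻ˡ : ∀ x a → act (act x (a ⁻)) a ≡ x)
  (faithful : ∀ {a b} → (∀ x → act x a ≡ act x b) → a ≡ b) where

  private
    module X = Inverse enumX
    module A = Inverse enumA

  table : A → Table n
  table a = Vec.tabulate λ i → X.to (act (X.from i) a)

  ^-table : ∀ i a → i ^ table a ≡ X.to (act (X.from i) a)
  ^-table i a = lookup∘tabulate _ i

  to-^-table : ∀ x a → X.to x ^ table a ≡ X.to (act x a)
  to-^-table x a = trans (^-table _ a) (cong (λ y → X.to (act y a)) (X.strictlyInverseʳ x))

  table-injective : ∀ {a b} → table a ≡ table b → a ≡ b
  table-injective {a} {b} eq = faithful λ x → ↔-injective enumX
    (trans (sym (to-^-table x a)) (trans (cong (X.to x ^_) eq) (to-^-table x b)))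

  table-∙ : ∀ a b → table a ∘T table b ≡ table (a ∙ b)
  table-∙ a b = tabulate-cong λ i → trans (cong (_^ table b) (^-table i a))
    (trans (to-^-table _ b) (cong X.to (sym (act-∙ (X.from i) a b))))

  table-⁻ʳ : ∀ i a → (i ^ table a) ^ table (a ⁻) ≡ i
  table-⁻ʳ i a = trans (cong (_^ table (a ⁻)) (^-table i a)) (trans (to-^-table _ (a ⁻))
    (trans (cong X.to (act-⁻ʳ _ a)) (X.strictlyInverseˡ i)))

  table-⁻ˡ : ∀ i a → (i ^ table (a ⁻)) ^ table a ≡ i
  table-⁻ˡ i a = trans (cong (_^ table a) (^-table i (a ⁻))) (trans (to-^-table _ a)
    (trans (cong X.to (act-⁻ˡ _ a)) (X.strictlyInverseˡ i)))

  table-perm : ∀ a → IsPerm (table a)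
  table-perm a i j eq = trans (sym (table-⁻ʳ i a)) (trans (cong (_^ table (a ⁻)) eq) (table-⁻ʳ j a))

  abstract
    listA : List A
    listA = List.tabulate A.from

    listA-unique : Unique listA
    listA-unique = Unique.tabulate⁺ (↔-injective (↔-sym enumA))

    ∈-listA : ∀ a → a ∈ listA
    ∈-listA a = subst (_∈ listA) (A.strictlyInverseʳ a) (∈-tabulate⁺ (A.to a))

  group : PermGroup n
  group = record
    { elems  = map table listA
    ; unique = Unique.map⁺ table-injective listA-unique
    ; perms  = All.tabulate perms′
    ; hasId  = subst (_∈ map table listA) table-ε (table∈ ε)
    ; closed = closed′
    }
    where
    table∈ : ∀ a → table a ∈ map table listA
    table∈ a = ∈-map⁺ table (∈-listA a)
    table-ε : table ε ≡ idT
    table-ε = tabulate-cong λ i → trans (cong X.to (act-ε _)) (X.strictlyInverseˡ i)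
    perms′ : ∀ {t} → t ∈ map table listA → IsPerm t
    perms′ t∈ with a , _ , refl ← ∈-map⁻ table t∈ = table-perm a
    closed′ : ∀ {s t} → s ∈ map table listA → t ∈ map table listA → (s ∘T t) ∈ map table listA
    closed′ s∈ t∈ with a , _ , refl ← ∈-map⁻ table s∈ | b , _ , refl ← ∈-map⁻ table t∈
      = subst (_∈ map table listA) (sym (table-∙ a b)) (table∈ (a ∙ b))

  table∈group : ∀ a → table a ∈ elems group
  table∈group a = ∈-map⁺ table (∈-listA a)

  ∈group⇒table : ∀ {t} → t ∈ elems group → ∃[ a ] t ≡ table a
  ∈group⇒table t∈ with a , _ , eq ← ∈-map⁻ table t∈ = a , eq

  transitive : (∀ x y → ∃[ a ] act x a ≡ y) → Transitive group
  transitive connect i j with a , eq ← connect (X.from i) (X.from j)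
    = table a , table∈group a , trans (^-table i a) (trans (cong X.to eq) (X.strictlyInverseˡ j))

  agree⇒Intersect : ∀ {a b} x → act x a ≡ act x b → Intersect (table a) (table b)
  agree⇒Intersect {a} {b} x eq = table (b ⁻) , (λ i → table-⁻ʳ i b) , X.to x ,
    trans (lookup∘tabulate _ (X.to x)) (trans (cong (_^ table (b ⁻))
      (trans (to-^-table x a) (trans (cong X.to eq) (sym (to-^-table x b)))))
      (table-⁻ʳ (X.to x) b))

  Intersect⇒agree : ∀ {a b} → Intersect (table a) (table b) → ∃[ x ] act x a ≡ act x b
  Intersect⇒agree {a} {b} (z , inv , i , fixed) = X.from i ,
    ↔-injective enumX (trans (sym (^-table i a)) (trans i^a≡i^b (^-table i b)))
    where
    -- `z` is an arbitrary inverse of `table b`. The point `j` is where `table (b ⁻)` sends the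
    -- image of `i`, and `inv j` shows that `z` sends it there too.
    j = (i ^ table a) ^ table (b ⁻)
    j≡i : j ≡ i
    j≡i = trans (sym (inv j)) (trans (cong (_^ z) (table-⁻ˡ _ b))
      (trans (sym (lookup∘tabulate _ i)) fixed))
    i^a≡i^b : i ^ table a ≡ i ^ table b
    i^a≡i^b = trans (sym (table-⁻ˡ (i ^ table a) b)) (cong (_^ table b) j≡i)

  select : {P : A → Set} → Decidable P → List (Table n)
  select P? = map table (filter P? listA)

  length-stab : ∀ {m} i (e : Fin m → A) → (∀ {j l} → e j ≡ e l → j ≡ l) →
    (∀ j → act (X.from i) (e j) ≡ X.from i) →
    (∀ {a} → act (X.from i) a ≡ X.from i → ∃[ j ] e j ≡ a) →
    length (stab group i) ≡ m
  length-stab i e inj fixes cover = length≡ (table ∘ e)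
    (Unique.filter⁺ (λ g → (i ^ g) ≟ i) (unique group)) (inj ∘ table-injective)
    (λ j → ∈-filter⁺ (λ g → (i ^ g) ≟ i) (table∈group (e j))
      (trans (^-table i (e j)) (trans (cong X.to (fixes j)) (X.strictlyInverseˡ i))))
    covered
    where
    covered : ∀ {t} → t ∈ stab group i → ∃[ j ] table (e j) ≡ t
    covered t∈ with ∈-filter⁻ (λ g → (i ^ g) ≟ i) {xs = elems group} t∈
    ... | t∈G , fixed with a , refl ← ∈group⇒table t∈G
      with j , refl ← cover (↔-injective enumX (trans (sym (^-table i a))
             (trans fixed (sym (X.strictlyInverseˡ i))))) = j , refl

  length-select : ∀ {m} {P : A → Set} (P? : Decidable P) (e : Fin m → A) →
    (∀ {j l} → e j ≡ e l → j ≡ l) → (∀ j → P (e j)) → (∀ {a} → P a → ∃[ j ] e j ≡ a) →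
    length (select P?) ≡ m
  length-select P? e inj eP cover = length≡ (table ∘ e)
    (Unique.map⁺ table-injective (Unique.filter⁺ P? listA-unique)) (inj ∘ table-injective)
    (λ j → ∈-map∘filter⁺ table P? (e j , ∈-listA (e j) , refl , eP j))
    covered
    where
    covered : ∀ {t} → t ∈ select P? → ∃[ j ] table (e j) ≡ t
    covered t∈ with a , _ , refl , Pa ← ∈-map∘filter⁻ table P? {xs = listA} t∈
      with j , refl ← cover Pa = j , refl

  select-intersecting : ∀ {P : A → Set} (P? : Decidable P) →
    (∀ {a b} → P a → P b → ∃[ x ] act x a ≡ act x b) → IntersectingSet (select P?)
  select-intersecting P? agree s∈ t∈
    with a , _ , refl , Pa ← ∈-map∘filter⁻ table P? {xs = listA} s∈
       | b , _ , refl , Pb ← ∈-map∘filter⁻ table P? {xs = listA} t∈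
    with x , same ← agree Pa Pb = agree⇒Intersect x same

  select-⊆ : ∀ {P : A → Set} (P? : Decidable P) → select P? ⊆ elems group
  select-⊆ P? = Sublist.map⁺ table (Sublist.filter-⊆ P? listA)

  -- Fix one element of S, given by b. Every element of S agrees with it at some point and so lies
  -- among the m elements `e b`.
  intersecting⇒length≤ : ∀ {m} (e : A → Fin m → A) →
    (∀ x {a b} → act x a ≡ act x b → ∃[ j ] e b j ≡ a) →
    ∀ S → S ⊆ elems group → IntersectingSet S → length S ℕ.≤ m
  intersecting⇒length≤ e agree [] _ _ = ℕ.z≤n
  intersecting⇒length≤ e agree S@(_ ∷ _) S⊆G int
    with b , refl ← ∈group⇒table (Sublist.lookup S⊆G (here refl))
    = covered⇒length≤ (table ∘ e b) (Unique-⊆ S⊆G (unique group)) covered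
    where
    covered : ∀ {s} → s ∈ S → ∃[ j ] table (e b j) ≡ s
    covered s∈
      with a , refl ← ∈group⇒table (Sublist.lookup S⊆G s∈)
      with x , same ← Intersect⇒agree (int s∈ (here refl))
      with j , refl ← agree x same = j , refl

-- The group L ⋊ C acting on the affine lines.

module LineGroup (F : BinaryField) where
  open QuadraticExtension F
  open Solver using (solve; con; _:=_; _:+_; _:*_)
  open ≡-Reasoning

  -- C acts regularly on the lines of L through 0L.
  C : Set
  C = Σ L λ w → N w ≡ 𝟙

  -- Decidable equality on K makes the norm proofs unique (Hedberg), so elements of `C` can be
  -- compared and counted as vectors.
  C-≡ : {u v : C} → proj₁ u ≡ proj₁ v → u ≡ v
  C-≡ {u , _} refl = cong (u ,_) (Decidable⇒UIP.≡-irrelevant _≟K_ _ _)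

  1C : C
  1C = 1L , N-1L

  _∘C_ : C → C → C
  (u , Nu) ∘C (v , Nv) = u ⊠ v ,
    trans (N-⊠ u v) (trans (cong₂ _·_ Nu Nv) (·-identityʳ 𝟙))

  conjC : C → C
  conjC (u , Nu) = conj u , trans (N-conj u) Nu

  C-inverse : (u : C) → proj₁ u ⊠ conj (proj₁ u) ≡ 1L
  C-inverse (u , Nu) = trans (⊠-conj u) (cong (_, 𝟘) Nu)

  cancel-conj : (w : C) (x : L) → proj₁ w ⊠ (conj (proj₁ w) ⊠ x) ≡ x
  cancel-conj w x = trans (sym (⊠-assoc _ _ x)) (trans (cong (_⊠ x) (C-inverse w)) (⊠-identityˡ x))

  conj-cancel : (w : C) (x : L) → conj (proj₁ w) ⊠ (proj₁ w ⊠ x) ≡ x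
  conj-cancel w x = trans (sym (⊠-assoc _ _ x)) (trans (cong (_⊠ x)
    (trans (⊠-comm _ (proj₁ w)) (C-inverse w))) (⊠-identityˡ x))

  ⊠-cancelˡ : (w : C) {x y : L} → proj₁ w ⊠ x ≡ proj₁ w ⊠ y → x ≡ y
  ⊠-cancelˡ w {x} {y} eq = trans (sym (conj-cancel w x))
    (trans (cong (conj (proj₁ w) ⊠_) eq) (conj-cancel w y))

  -- Scaling by k multiplies the norm by k², so reaching norm `𝟙` requires k² = 1 / N z.
  norm-factor : L → Carrier
  norm-factor z = √ (N z ⁻¹)

  abstract
    N-normalised : ∀ {z} → z ≢ 0L → N (scale (norm-factor z) z) ≡ 𝟙
    N-normalised {z} z≢0 = begin
      N (scale (norm-factor z) z)            ≡⟨ N-scale _ z ⟩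
      norm-factor z · norm-factor z · N z    ≡⟨ cong (_· N z) (√-square (N z ⁻¹)) ⟩
      N z ⁻¹ · N z                           ≡⟨ ·-comm _ (N z) ⟩
      N z · N z ⁻¹                           ≡⟨ ⁻¹-inverse (z≢0 ∘ N≡𝟘⇒≡0L z) ⟩
      𝟙                                      ∎

  unit : (z : L) → z ≢ 0L → C
  unit z z≢0 = scale (norm-factor z) z , N-normalised z≢0

  -- Both scalars have square 1 / N z, and square roots are unique in characteristic 2.
  unit-unique : ∀ {z k} (z≢0 : z ≢ 0L) → N (scale k z) ≡ 𝟙 → norm-factor z ≡ k
  unit-unique {z} {k} z≢0 Nkz = square-injective (begin
    s · s                      ≡⟨ ·-identityʳ _ ⟨
    s · s · 𝟙                  ≡⟨ cong (s · s ·_) (trans (sym Nkz) (N-scale k z)) ⟩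
    s · s · (k · k · N z)      ≡⟨ solve 3 (λ s k n → s :* s :* (k :* k :* n)
                                   := k :* k :* (s :* s :* n)) refl s k (N z) ⟩
    k · k · (s · s · N z)      ≡⟨ cong (k · k ·_) (trans (sym (N-scale s z)) (N-normalised z≢0)) ⟩
    k · k · 𝟙                  ≡⟨ ·-identityʳ _ ⟩
    k · k                      ∎)
    where s = norm-factor z

  ,𝟙≢0L : ∀ {t} → (t , 𝟙) ≢ 0L
  ,𝟙≢0L = 𝟘≢𝟙 ∘ sym ∘ cong proj₂

  -- This gives |C| = q + 1. A norm-one vector is recovered from its slope a / b by normalising; the
  -- point at infinity is the direction K, whose only norm-one vector is `1L`.
  C↔ℙ¹ : C ↔ (⊤ ⊎ Carrier)
  C↔ℙ¹ = mk↔ₛ′ to from to-from from-to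
    where
    slope : (a b : Carrier) → Dec (b ≡ 𝟘) → ⊤ ⊎ Carrier
    slope a b (yes _) = inj₁ tt
    slope a b (no  _) = inj₂ (a · b ⁻¹)

    to : C → ⊤ ⊎ Carrier
    to ((a , b) , _) = slope a b (b ≟K 𝟘)

    from : ⊤ ⊎ Carrier → C
    from (inj₁ _) = 1C
    from (inj₂ t) = unit (t , 𝟙) ,𝟙≢0L

    slope-∞ : ∀ {a} b≟0 → slope a 𝟘 b≟0 ≡ inj₁ tt
    slope-∞ (yes _)  = refl
    slope-∞ (no 0≢0) = contradiction refl 0≢0

    slope-scale : ∀ s t → N (scale s (t , 𝟙)) ≡ 𝟙 → ∀ s1≟0 → slope (s · t) (s · 𝟙) s1≟0 ≡ inj₂ t
    slope-scale s t Nst≡1 (yes s1≡0) = contradiction (begin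
      𝟘                        ≡⟨ ·-zeroˡ _ ⟨
      𝟘 · N (t , 𝟙)            ≡⟨ cong (_· N (t , 𝟙)) (·-zeroˡ 𝟘) ⟨
      𝟘 · 𝟘 · N (t , 𝟙)        ≡⟨ cong (λ s → s · s · N (t , 𝟙)) (trans (sym (·-identityʳ s)) s1≡0) ⟨
      s · s · N (t , 𝟙)        ≡⟨ N-scale s (t , 𝟙) ⟨
      N (scale s (t , 𝟙))      ≡⟨ Nst≡1 ⟩
      𝟙                        ∎) 𝟘≢𝟙
    slope-scale s t _ (no s1≢0) = cong inj₂ (begin
      s · t · (s · 𝟙) ⁻¹
        ≡⟨ solve 3 (λ s t i → s :* t :* i := t :* (s :* con true :* i)) refl s t ((s · 𝟙) ⁻¹) ⟩
      t · (s · 𝟙 · (s · 𝟙) ⁻¹)     ≡⟨ cong (t ·_) (⁻¹-inverse s1≢0) ⟩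
      t · 𝟙                        ≡⟨ ·-identityʳ t ⟩
      t                            ∎)

    to-from : ∀ p → to (from p) ≡ p
    to-from (inj₁ tt) = slope-∞ (𝟘 ≟K 𝟘)
    to-from (inj₂ t)  = slope-scale _ t (N-normalised ,𝟙≢0L) _

    from-slope : ∀ a b (Nu : N (a , b) ≡ 𝟙) b≟0 → proj₁ (from (slope a b b≟0)) ≡ (a , b)
    from-slope a b Nu (yes refl) = cong (_, 𝟘) (square-injective (begin
      𝟙 · 𝟙        ≡⟨ ·-identityʳ 𝟙 ⟩
      𝟙            ≡⟨ Nu ⟨
      N (a , 𝟘)    ≡⟨ solve 2 (λ c a → a :* a :+ a :* con false :+ c :* con false :* con false
                        := a :* a) refl c a ⟩
      a · a        ∎))
    from-slope a b Nu (no b≢0) =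
      trans (cong (λ k → scale k z) (unit-unique ,𝟙≢0L (trans (cong N scale-b) Nu))) scale-b
      where
      z : L
      z = a · b ⁻¹ , 𝟙
      scale-b : scale b z ≡ (a , b)
      scale-b = cong₂ _,_ (begin
        b · (a · b ⁻¹)   ≡⟨ solve 3 (λ a b i → b :* (a :* i) := a :* (b :* i)) refl a b (b ⁻¹) ⟩
        a · (b · b ⁻¹)   ≡⟨ cong (a ·_) (⁻¹-inverse b≢0) ⟩
        a · 𝟙            ≡⟨ ·-identityʳ a ⟩
        a                ∎) (·-identityʳ b)

    from-to : ∀ u → from (to u) ≡ u
    from-to ((a , b) , Nu) = C-≡ (from-slope a b Nu (b ≟K 𝟘))

  enumC : C ↔ Fin (suc order)
  enumC = ↔-trans C↔ℙ¹ (↔-trans (↔-sym 1↔⊤ ⊎-↔ enum) (↔-sym +↔⊎))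

  -- The point (w , o) is the affine line { x | π (w ⊠ x) ≡ o }, written additively
  -- on the right: translations by b shift o by π (w ⊠ b).
  Ω A : Set
  Ω = C × Carrier
  A = C × L

  -- The α-coordinate is a nonzero K-linear functional with kernel K. As w runs through C, the
  -- functionals x ↦ π (w x) represent each direction once, by their kernels.
  π : L → Carrier
  π = proj₂

  -- On vectors, (a , b) is the map x ↦ a⁻¹ (x + b): the translation moves the offset, and
  -- multiplication by a⁻¹ replaces w by w a. The formulas for `_∙_` and `_⁻` follow from this map.
  act : Ω → A → Ω
  act (w , o) (a , b) = (w ∘C a) , (o ⊕ π (proj₁ w ⊠ b))

  enumΩ : Ω ↔ Fin (suc order ℕ.* order)
  enumΩ = ↔-trans (enumC ×-↔ enum) (↔-sym *↔×)

  enumA : A ↔ Fin (suc order ℕ.* (order ℕ.* order))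
  enumA = ↔-trans (enumC ×-↔ enumL) (↔-sym *↔×)

  _∙_ : A → A → A
  (a , b) ∙ (a′ , b′) = (a ∘C a′) , (b ⊞ proj₁ a ⊠ b′)

  _⁻ : A → A
  (a , b) ⁻ = conjC a , conj (proj₁ a) ⊠ b

  act-ε : ∀ x → act x (1C , 0L) ≡ x
  act-ε (w , o) = cong₂ _,_ (C-≡ (⊠-identityʳ _))
    (trans (cong (o ⊕_) (cong π (trans (⊠-comm _ 0L) (⊠-zeroˡ _)))) (⊕-identityʳ o))

  act-∙ : ∀ x a b → act x (a ∙ b) ≡ act (act x a) b
  act-∙ (w , o) (a , b) (a′ , b′) = cong₂ _,_ (C-≡ (sym (⊠-assoc _ _ _)))
    (trans (cong (o ⊕_) (cong π (trans (⊠-distribˡ (proj₁ w) b _)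
      (cong (proj₁ w ⊠ b ⊞_) (sym (⊠-assoc _ _ _)))))) (sym (⊕-assoc _ _ _)))

  ⊕-cancelʳ : ∀ x y → x ⊕ y ⊕ y ≡ x
  ⊕-cancelʳ x y = trans (⊕-assoc x y y) (trans (cong (x ⊕_) (⊕-self y)) (⊕-identityʳ x))

  act-⁻ʳ : ∀ x a → act (act x a) (a ⁻) ≡ x
  act-⁻ʳ (w , o) (a , b) = cong₂ _,_
    (C-≡ (trans (⊠-assoc _ _ _) (trans (cong (proj₁ w ⊠_) (C-inverse a)) (⊠-identityʳ _))))
    (trans (cong (λ z → o ⊕ π (proj₁ w ⊠ b) ⊕ π z)
      (trans (⊠-assoc (proj₁ w) _ _) (cong (proj₁ w ⊠_) (cancel-conj a b))))
      (⊕-cancelʳ o _))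

  act-⁻ˡ : ∀ x a → act (act x (a ⁻)) a ≡ x
  act-⁻ˡ (w , o) (a , b) = cong₂ _,_
    (C-≡ (trans (⊠-assoc _ _ _) (trans (cong (proj₁ w ⊠_)
      (trans (⊠-comm _ (proj₁ a)) (C-inverse a))) (⊠-identityʳ _))))
    (trans (cong (λ z → o ⊕ π (proj₁ w ⊠ (conj (proj₁ a) ⊠ b)) ⊕ π z) (⊠-assoc (proj₁ w) _ _))
      (⊕-cancelʳ o _))

  -- Multiplication by w is injective, so the image direction w a determines a; the offset cancels
  -- because it is added twice.
  act≡⇒ : ∀ w o {a a′ b b′} → act (w , o) (a , b) ≡ act (w , o) (a′ , b′) →
    a ≡ a′ × π (proj₁ w ⊠ b) ≡ π (proj₁ w ⊠ b′)
  act≡⇒ w o eq = C-≡ (⊠-cancelˡ w (cong (proj₁ ∘ proj₁) eq)) ,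
    trans (cancel _) (trans (cong ((o ⊕_) ∘ proj₂) eq) (sym (cancel _)))
    where
    cancel : ∀ x → x ≡ o ⊕ (o ⊕ x)
    cancel x = solve 2 (λ o x → x := o :+ (o :+ x)) refl o x

  -- The normalised conjugate of β works, since conj β times β is the norm of β, an element of K,
  -- where π vanishes.
  C-direction : ∀ β → Σ C λ w → π (proj₁ w ⊠ β) ≡ 𝟘
  C-direction β with N β ≟K 𝟘
  ... | yes Nβ≡0 rewrite N≡𝟘⇒≡0L β Nβ≡0 = 1C , cong π (⊠-identityˡ 0L)
  ... | no  Nβ≢0 = unit (conj β) (λ eq → Nβ≢0 (trans (sym (N-conj β)) (trans (cong N eq) N-0L))) ,
    trans (cong π (trans (scale-⊠ s (conj β) β) (cong (scale s) (trans (⊠-comm _ β) (⊠-conj β)))))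
      (·-zeroʳ s)
    where
    s = norm-factor (conj β)
    N-0L : N 0L ≡ 𝟘
    N-0L = solve 1 (λ c → con false :* con false :+ con false :* con false :+ c :* con false :* con false
                        := con false) refl c

  infix 4 _≟C_
  abstract
    _≟C_ : DecidableEquality C
    _≟C_ = via-injection (↔⇒↣ enumC) _≟_

  faithful : ∀ {a b} → (∀ x → act x a ≡ act x b) → a ≡ b
  faithful {a , x₁ , x₂} {a′ , y₁ , y₂} same = cong₂ _,_ (proj₁ at-1C) (cong₂ _,_ x₁≡y₁ x₂≡y₂)
    where
    at-1C = act≡⇒ 1C 𝟘 (same (1C , 𝟘))

    x₂≡y₂ : x₂ ≡ y₂
    x₂≡y₂ = trans (sym (cong π (⊠-identityˡ (x₁ , x₂))))
      (trans (proj₂ at-1C) (cong π (⊠-identityˡ (y₁ , y₂))))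

    w : C
    -- Two independent functionals determine a translation. The line through `1C` reads off the
    -- second coordinate; multiplication by α turns x + y α into c y + (x + y) α, so this direction
    -- reads off the sum of the coordinates up to the factor s.
    w = unit (𝟘 , 𝟙) ,𝟙≢0L
    s = norm-factor (𝟘 , 𝟙)

    s≢𝟘 : s ≢ 𝟘
    s≢𝟘 s≡0 = 𝟘≢𝟙 (begin
      𝟘                    ≡⟨ ·-zeroˡ (N (𝟘 , 𝟙)) ⟨
      𝟘 · N (𝟘 , 𝟙)        ≡⟨ cong (_· N (𝟘 , 𝟙)) (·-zeroˡ 𝟘) ⟨
      𝟘 · 𝟘 · N (𝟘 , 𝟙)    ≡⟨ cong (λ s → s · s · N (𝟘 , 𝟙)) s≡0 ⟨
      s · s · N (𝟘 , 𝟙)    ≡⟨ N-scale s (𝟘 , 𝟙) ⟨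
      N (proj₁ w)          ≡⟨ proj₂ w ⟩
      𝟙                    ∎)

    π-w : ∀ x y → π (proj₁ w ⊠ (x , y)) ≡ s · (x ⊕ y)
    π-w x y = solve 3 (λ s x y →
      (s :* con false) :* y :+ (s :* con true) :* x :+ (s :* con true) :* y := s :* (x :+ y))
      refl s x y

    x₁≡y₁ : x₁ ≡ y₁
    x₁≡y₁ = ⊕≡𝟘⇒≡ (·-cancel-𝟘 s≢𝟘 (begin
      s · (x₁ ⊕ y₁)
        ≡⟨ solve 4 (λ s x₁ y₁ y₂ → s :* (x₁ :+ y₁) := s :* (x₁ :+ y₂) :+ s :* (y₁ :+ y₂)) refl s x₁ y₁ y₂ ⟩
      s · (x₁ ⊕ y₂) ⊕ s · (y₁ ⊕ y₂)
        ≡⟨ cong₂ _⊕_ (cong (λ x₂ → s · (x₁ ⊕ x₂)) (sym x₂≡y₂)) (sym (π-w y₁ y₂)) ⟩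
      s · (x₁ ⊕ x₂) ⊕ π (proj₁ w ⊠ (y₁ , y₂))
        ≡⟨ cong₂ _⊕_ (π-w x₁ x₂) (proj₂ (act≡⇒ w 𝟘 (same (w , 𝟘)))) ⟨
      π (proj₁ w ⊠ (x₁ , x₂)) ⊕ π (proj₁ w ⊠ (x₁ , x₂))
        ≡⟨ ⊕-self _ ⟩
      𝟘 ∎))

  private
    module Rep = FaithfulAction enumΩ enumA act _∙_ (1C , 0L) _⁻ act-ε act-∙ act-⁻ʳ act-⁻ˡ faithful
  open Rep public using (group)

  transitive : Transitive group
  transitive = Rep.transitive λ { (w , o) (w′ , o′) →
    -- The conjugate of w is its inverse, so w times the translation part is (𝟘 , o ⊕ o′), whose
    -- image under π is the offset still missing.
    (conjC w ∘C w′ , conj (proj₁ w) ⊠ (𝟘 , o ⊕ o′)) ,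
    cong₂ _,_ (C-≡ (cancel-conj w (proj₁ w′)))
      (trans (cong (λ z → o ⊕ π z) (cancel-conj w _))
        (solve 2 (λ o o′ → o :+ (o :+ o′) := o′) refl o o′)) }

  -- Freeness on directions forces a stabilising element to be a translation by some b with π (w b)
  -- = 0. Then w b lies in K, and b in the conjugate of w times K, which is the direction of the
  -- line.
  stabiliser-order : ∀ i → length (stab group i) ≡ order
  stabiliser-order i = Rep.length-stab i e
    (λ eq → ↔-injective (↔-sym enum) (cong proj₁ (conj-⊠-cancelˡ (cong proj₂ eq))))
    (λ j → cong₂ _,_ (C-≡ (⊠-identityʳ _))
      (trans (cong (λ z → o ⊕ π z) (cancel-conj w _)) (⊕-identityʳ o)))
    cover
    where
    w = proj₁ (Inverse.from enumΩ i)
    o = proj₂ (Inverse.from enumΩ i)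

    e : Fin order → A
    e j = 1C , conj (proj₁ w) ⊠ (Inverse.from enum j , 𝟘)

    conj-⊠-cancelˡ : ∀ {x y} → conj (proj₁ w) ⊠ x ≡ conj (proj₁ w) ⊠ y → x ≡ y
    conj-⊠-cancelˡ = ⊠-cancelˡ (conjC w)

    cover : ∀ {a} → act (w , o) a ≡ (w , o) → ∃[ j ] e j ≡ a
    cover {a , b} fixed = Inverse.to enum (proj₁ (proj₁ w ⊠ b)) , cong₂ _,_ (sym a≡1C)
      (trans (cong (conj (proj₁ w) ⊠_) (cong₂ _,_ (Inverse.strictlyInverseʳ enum _)
        (sym (trans π≡ (cong π (trans (⊠-comm _ 0L) (⊠-zeroˡ _))))))) (conj-cancel w b))
      where
      a≡1C×π≡ = act≡⇒ w o (trans fixed (sym (act-ε (w , o))))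
      a≡1C = proj₁ a≡1C×π≡
      π≡   = proj₂ a≡1C×π≡

  IsTranslation : A → Set
  IsTranslation (a , _) = a ≡ 1C

  isTranslation? : Decidable IsTranslation
  isTranslation? (a , _) = a ≟C 1C

  translations : List (Table (suc order ℕ.* order))
  translations = Rep.select isTranslation?

  length-translations : length translations ≡ order ℕ.* order
  length-translations = Rep.length-select isTranslation? (λ j → 1C , Inverse.from enumL j)
    (↔-injective (↔-sym enumL) ∘ cong proj₂) (λ _ → refl)
    (λ { {a , b} refl → Inverse.to enumL b , cong (1C ,_) (Inverse.strictlyInverseʳ enumL b) })

  -- Two translations agree on every line whose direction contains their difference.
  translations-agree : ∀ b b′ → ∃[ x ] act x (1C , b) ≡ act x (1C , b′)
  translations-agree b b′ with w , w-kills ← C-direction (b ⊞ b′)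
    = (w , 𝟘) , cong (λ y → w ∘C 1C , 𝟘 ⊕ y) (⊕≡𝟘⇒≡
        (trans (sym (cong π (⊠-distribˡ (proj₁ w) b b′))) w-kills))

  agreeing : A → Fin (order ℕ.* order) → A
  agreeing (a , _) j = a , Inverse.from enumL j

  -- Intersecting elements induce the same permutation of the directions.
  agree⇒agreeing : ∀ x {a b} → act x a ≡ act x b → ∃[ j ] agreeing b j ≡ a
  agree⇒agreeing (w , o) {_ , b} same = Inverse.to enumL b ,
    cong₂ _,_ (sym (proj₁ (act≡⇒ w o same))) (Inverse.strictlyInverseʳ enumL b)

  translations-maximum : MaxIntersecting group translations
  translations-maximum =
    Rep.select-⊆ isTranslation? ,
    Rep.select-intersecting isTranslation? (λ { {_ , b} {_ , b′} refl refl → translations-agree b b′ }) ,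
    λ S′ S′⊆G int → subst (length S′ ℕ.≤_) (sym length-translations)
      (Rep.intersecting⇒length≤ agreeing agree⇒agreeing S′ S′⊆G int)

-- The degree q (q + 1) is not a proper power; growth of q.

module _ where
  open import Data.Nat using (_+_; _*_; _≤_; _<_; z≤n; s≤s; z<s) renaming (_^_ to _^ℕ_)
  open import Data.Nat.Properties
  open import Data.Nat.Solver using (module +-*-Solver)

  Odd : ℕ → Set
  Odd n = ∃[ h ] n ≡ suc (2 * h)

  Odd-* : ∀ {m n} → Odd m → Odd n → Odd (m * n)
  Odd-* (h , refl) (k , refl) = h + k + 2 * h * k ,
    solve 2 (λ h k → (con 1 :+ con 2 :* h) :* (con 1 :+ con 2 :* k)
                  := con 1 :+ con 2 :* (h :+ k :+ con 2 :* h :* k)) refl h k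
    where open +-*-Solver

  Odd-^ : ∀ {m} n → Odd m → Odd (m ^ℕ n)
  Odd-^ zero    _   = 0 , refl
  Odd-^ (suc n) odd = Odd-* odd (Odd-^ n odd)

  even⊎odd : ∀ n → (∃[ h ] n ≡ 2 * h) ⊎ Odd n
  even⊎odd zero = inj₁ (0 , refl)
  even⊎odd (suc n) with even⊎odd n
  ... | inj₁ (h , refl) = inj₂ (h , refl)
  ... | inj₂ (h , refl) = inj₁ (suc h , sym (*-suc 2 h))

  2^*odd : ∀ n → 0 < n → ∃₂ λ j c → Odd c × n ≡ 2 ^ℕ j * c
  2^*odd = <-rec _ step
    where
    step : ∀ n → (∀ {m} → m < n → 0 < m → ∃₂ λ j c → Odd c × m ≡ 2 ^ℕ j * c) →
           0 < n → ∃₂ λ j c → Odd c × n ≡ 2 ^ℕ j * c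
    step n rec 0<n with even⊎odd n
    ... | inj₂ odd = 0 , n , odd , sym (*-identityˡ n)
    ... | inj₁ (suc h , refl) with j , c , odd , eq ← rec (m<m+n (suc h) z<s) z<s
      = suc j , c , odd , trans (cong (2 *_) eq) (sym (*-assoc 2 (2 ^ℕ j) c))

  -- This takes the place of unique factorisation: it compares the 2-part and the odd part of a b-th
  -- power separately.
  2^*odd-unique : ∀ i j {c d} → Odd c → Odd d → 2 ^ℕ i * c ≡ 2 ^ℕ j * d → i ≡ j × c ≡ d
  2^*odd-unique zero zero _ _ eq = refl , +-cancelʳ-≡ 0 _ _ eq
  2^*odd-unique zero (suc j) {d = d} (h , refl) _ eq = contradiction
    (trans (sym (*-assoc 2 (2 ^ℕ j) d)) (trans (sym eq) (*-identityˡ _))) (even≢odd (2 ^ℕ j * d) h)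
  2^*odd-unique (suc i) zero {c = c} _ (h , refl) eq = contradiction
    (trans (sym (*-assoc 2 (2 ^ℕ i) c)) (trans eq (*-identityˡ _))) (even≢odd (2 ^ℕ i * c) h)
  2^*odd-unique (suc i) (suc j) {c} {d} oc od eq
    with refl , c≡d ← 2^*odd-unique i j oc od (*-cancelˡ-≡ _ _ 2
           (trans (sym (*-assoc 2 (2 ^ℕ i) c)) (trans eq (*-assoc 2 (2 ^ℕ j) d))))
    = refl , c≡d

  ^-distribʳ-* : ∀ m n o → (m * n) ^ℕ o ≡ m ^ℕ o * n ^ℕ o
  ^-distribʳ-* m n zero    = refl
  ^-distribʳ-* m n (suc o) = trans (cong (m * n *_) (^-distribʳ-* m n o))
    (solve 4 (λ m n x y → m :* n :* (x :* y) := m :* x :* (n :* y)) refl m n (m ^ℕ o) (n ^ℕ o))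
    where open +-*-Solver

  -- If c > x, then c^b ≥ (x + 1)^b = (x + 1)^(b-1) + x (x + 1)^(b-1). The first summand is at least
  -- 2 and the second at least x^b, so the gap exceeds 1.
  consecutive-not-both-powers : ∀ x c b → 0 < x → 2 ≤ b → c ^ℕ b ≢ suc (x ^ℕ b)
  consecutive-not-both-powers x c b@(suc (suc b′)) 0<x _ eq with c ≤? x
  ... | yes c≤x = 1+n≰n (≤-trans (≤-reflexive (sym eq)) (^-monoˡ-≤ b c≤x))
  ... | no  c≰x = 1+n≰n (begin
    2 + x ^ℕ b                                   ≤⟨ +-mono-≤ 2≤ (*-monoʳ-≤ x (^-monoˡ-≤ (suc b′) (n≤1+n x))) ⟩
    suc x ^ℕ suc b′ + x * suc x ^ℕ suc b′         ≤⟨ ^-monoˡ-≤ b (≰⇒> c≰x) ⟩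
    c ^ℕ b                                       ≡⟨ eq ⟩
    1 + x ^ℕ b                                   ∎)
    where
    open ≤-Reasoning
    2≤ : 2 ≤ suc x ^ℕ suc b′
    2≤ = *-mono-≤ (s≤s 0<x) (m^n>0 (suc x) b′)
  consecutive-not-both-powers _ _ (suc zero) _ (s≤s ())

  -- 2^k and 2^k + 1 are coprime, so if their product were a b-th power, both would be.
  pronic-2^-not-power : ∀ k a b → 2 ≤ b → a ^ℕ b ≢ suc (2 ^ℕ suc k) * 2 ^ℕ suc k
  pronic-2^-not-power k zero (suc _) _ eq =
    <⇒≢ (≤-trans (m^n>0 2 (suc k)) (m≤m+n (2 ^ℕ suc k) _)) eq
  pronic-2^-not-power k a@(suc _) b 2≤b eq with j , c , odd-c , a≡ ← 2^*odd a z<s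
    = consecutive-not-both-powers (2 ^ℕ j) c b (m^n>0 2 j) 2≤b (begin
        c ^ℕ b               ≡⟨ proj₂ parts ⟩
        suc (2 ^ℕ suc k)     ≡⟨ cong (suc ∘ (2 ^ℕ_)) (proj₁ parts) ⟨
        suc (2 ^ℕ (j * b))   ≡⟨ cong suc (^-*-assoc 2 j b) ⟨
        suc ((2 ^ℕ j) ^ℕ b)   ∎)
    where
    open ≡-Reasoning
    parts : j * b ≡ suc k × c ^ℕ b ≡ suc (2 ^ℕ suc k)
    -- The pair `(2 ^ℕ k , refl)` witnesses that q + 1 is odd, which is why the exponent of q has
    -- the form `suc k`.
    parts = 2^*odd-unique (j * b) (suc k) (Odd-^ b odd-c) (2 ^ℕ k , refl) (begin
      2 ^ℕ (j * b) * c ^ℕ b           ≡⟨ cong (_* c ^ℕ b) (^-*-assoc 2 j b) ⟨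
      (2 ^ℕ j) ^ℕ b * c ^ℕ b           ≡⟨ ^-distribʳ-* (2 ^ℕ j) c b ⟨
      (2 ^ℕ j * c) ^ℕ b               ≡⟨ cong (_^ℕ b) a≡ ⟨
      a ^ℕ b                         ≡⟨ eq ⟩
      suc (2 ^ℕ suc k) * 2 ^ℕ suc k   ≡⟨ *-comm (suc (2 ^ℕ suc k)) (2 ^ℕ suc k) ⟩
      2 ^ℕ suc k * suc (2 ^ℕ suc k)   ∎)

  Vec↔Fin : ∀ a b → Vec (Fin a) b ↔ Fin (a ^ℕ b)
  Vec↔Fin a zero    = ↔-trans (mk↔ₛ′ _ (λ _ → []) (λ _ → refl) (λ { [] → refl })) (↔-sym 1↔⊤)
  Vec↔Fin a (suc b) = ↔-trans
    (mk↔ₛ′ (λ v → Vec.head v , Vec.tail v) (λ (x , v) → x ∷ v) (λ _ → refl) (λ { (_ ∷ _) → refl }))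
    (↔-trans (↔-refl ×-↔ Vec↔Fin a b) (↔-sym *↔×))

  decomposition⇒power : ∀ {n} {G : PermGroup n} → AdmitsProductDecomposition G →
    ∃₂ λ a b → 2 ≤ b × a ^ℕ b ≡ n
  decomposition⇒power (a , b , _ , _ , _ , 2≤b , φ , _) =
    a , b , 2≤b , sym (Permutation.↔⇒≡ (↔-trans φ (Vec↔Fin a b)))

  open BinaryField using (order)

  tower-order : ∀ i → ∃[ k ] order (tower i) ≡ 2 ^ℕ suc k
  tower-order zero = 0 , refl
  tower-order (suc i) with k , eq ← tower-order i
    = k + suc k , trans (cong₂ _*_ eq eq) (sym (^-distribˡ-+-* 2 (suc k) (suc k)))

  n<tower-order : ∀ i → i < order (tower i)
  n<tower-order zero    = z<s
  n<tower-order (suc i) = begin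
    2 + i        ≤⟨ +-monoʳ-≤ 1 (n<tower-order i) ⟩
    1 + q        ≤⟨ +-monoˡ-≤ q (≤-trans z<s (n<tower-order i)) ⟩
    q + q        ≡⟨ cong (q +_) (+-identityʳ q) ⟨
    2 * q        ≤⟨ *-monoˡ-≤ q 2≤q ⟩
    q * q        ∎
    where
    open ≤-Reasoning
    q = order (tower i)
    2≤q : 2 ≤ q
    2≤q with k , eq ← tower-order i = ≤-trans (*-monoʳ-≤ 2 (m^n>0 2 k)) (≤-reflexive (sym eq))

  no-product-decomposition : ∀ i → ¬ AdmitsProductDecomposition (LineGroup.group (tower i))
  no-product-decomposition i decomposition
    with a , b , 2≤b , eq ← decomposition⇒power {G = LineGroup.group (tower i)} decomposition
    with k , q≡ ← tower-order i
    = pronic-2^-not-power k a b 2≤b (trans eq (cong (λ q → suc q * q) q≡))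

-- Rational estimates and the choice of q.

open import Data.Integer as ℤ using (+_; -[1+_]; +<+; +≤+)
import Data.Integer.Properties as ℤ
import Data.Nat.Coprimality as Coprime
open import Data.Rational as ℚ using (ℚ; mkℚ; *<*; _<_; _≤_; _+_; _*_; _-_; 0ℚ; 1ℚ; _/_)
import Data.Rational.Properties as ℚ
open import Data.Rational.Solver using (module +-*-Solver)
open import Data.Rational.Unnormalised using (mkℚᵘ; *≡*; *≤*)
import Data.Rational.Unnormalised.Properties as ℚᵘ

ι : ℕ → ℚ
ι n = (+ n) / 1

-- `_/_` divides by a gcd that does not compute for a variable n; the explicit form exposes
-- numerator and denominator.
ι≡mkℚ : ∀ n → ι n ≡ mkℚ (+ n) 0 (Coprime.sym (Coprime.1-coprimeTo n))
ι≡mkℚ n = ℚ.fromℚᵘ-toℚᵘ (mkℚ (+ n) 0 _)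

ι-* : ∀ m n → ι (m ℕ.* n) ≡ ι m * ι n
ι-* m n = sym (trans (cong₂ _*_ (ι≡mkℚ m) (ι≡mkℚ n)) (cong (_/ 1) (sym (ℤ.pos-* m n))))

ι-suc : ∀ n → ι (suc n) ≡ 1ℚ + ι n
ι-suc n = sym (trans (cong (λ x → 1ℚ + x) (ι≡mkℚ n))
  (cong (λ z → (+ 1 ℤ.+ z) / 1) (ℤ.*-identityʳ (+ n))))

ratio≡ι : ∀ {s g} q-1 .{{_ : NonZero g}} → s ≡ suc q-1 ℕ.* suc q-1 → g ≡ suc q-1 →
  ratio s g ≡ ι (suc q-1)
ratio≡ι q-1 refl refl = ℚ.fromℚᵘ-cong {mkℚᵘ (+ (q ℕ.* q)) q-1} {mkℚᵘ (+ q) 0}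
  (*≡* (trans (ℤ.*-identityʳ _) (ℤ.pos-* q q)))
  where q = suc q-1

-- A nonnegative rational is at most its numerator, the denominator being at least 1.
<-ι : ∀ {M} q → ℤ.∣ ℚ.numerator M ∣ ℕ.< q → M < ι q
<-ι {M@(mkℚ (+ a) d-1 _)} q a<q = subst (M <_) (sym (ι≡mkℚ q)) (*<* (subst₂ ℤ._<_
  (sym (ℤ.*-identityʳ (+ a))) (ℤ.pos-* q (suc d-1))
  (+<+ (ℕ.<-≤-trans a<q (ℕ.m≤m*n q (suc d-1))))))
<-ι {M@(mkℚ -[1+ a ] d-1 _)} q _ = subst (M <_) (sym (ι≡mkℚ q)) (*<* (subst (-[1+ _ ] ℤ.<_)
  (ℤ.pos-* q (suc d-1)) ℤ.-<+))

ι-mono-< : ∀ m n → m ℕ.< n → ι m < ι n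
ι-mono-< m n m<n = <-ι n (subst (λ x → ℤ.∣ ℚ.numerator x ∣ ℕ.< n) (sym (ι≡mkℚ m)) m<n)

-- A positive ε with denominator d has numerator at least 1, hence is at least 1 / d.
1≤*ι : ∀ {ε} s → 0ℚ < ε → ℚ.denominatorℕ ε ℕ.≤ s → 1ℚ ≤ ε * ι s
1≤*ι {ε@(mkℚ (+ suc a) d-1 _)} s _ d≤s = subst (λ x → 1ℚ ≤ ε * x) (sym (ι≡mkℚ s))
  (ℚ.toℚᵘ-cancel-≤ (ℚᵘ.≤-respʳ-≃ (ℚᵘ.≃-sym (ℚ.toℚᵘ-homo-* ε (mkℚ (+ s) 0 (Coprime.sym (Coprime.1-coprimeTo s)))))
    (*≤* (subst₂ ℤ._≤_ (sym (trans (ℤ.*-identityˡ _) (cong +_ (ℕ.*-identityʳ (suc d-1)))))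
      (trans (ℤ.pos-* (suc a) s) (sym (ℤ.*-identityʳ _)))
      (+≤+ (ℕ.≤-trans d≤s (ℕ.m≤n*m s (suc a))))))))
1≤*ι {mkℚ (+ 0) _ _}    _ (*<* (+<+ ())) _
1≤*ι {mkℚ -[1+ _ ] _ _} _ (*<* ()) _

-- Here (1 + Q) Q is the degree. The bound on ε (1 + Q) says that (1 - ε)(1 + Q) ≤ Q, which uses up
-- one factor 1 - ε; the other is below 1 and gives strictness.
square-bound : ∀ ε Q → ε < 1ℚ → 0ℚ < ε → 0ℚ < Q → 1ℚ ≤ ε * (1ℚ + Q) →
  (1ℚ - ε) * (1ℚ - ε) * ((1ℚ + Q) * Q) < Q * Q
square-bound ε Q ε<1 0<ε 0<Q large = begin-strict
  δ * δ * ((1ℚ + Q) * Q)                  ≡⟨ solve 2 (λ δ Q → δ :* δ :* ((con 1ℚ :+ Q) :* Q)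
                                               := δ :* (δ :* (con 1ℚ :+ Q)) :* Q) refl δ Q ⟩
  δ * (δ * (1ℚ + Q)) * Q                  ≤⟨ ℚ.*-monoʳ-≤-nonNeg Q (ℚ.*-monoˡ-≤-nonNeg δ step) ⟩
  δ * Q * Q                               <⟨ ℚ.*-monoˡ-<-pos Q (ℚ.*-monoˡ-<-pos Q δ<1) ⟩
  1ℚ * Q * Q                              ≡⟨ cong (_* Q) (ℚ.*-identityˡ Q) ⟩
  Q * Q                                   ∎
  where
  open ℚ.≤-Reasoning
  open +-*-Solver
  δ = 1ℚ - ε
  0<δ : 0ℚ < δ
  0<δ = subst (_< δ) (ℚ.+-inverseʳ ε) (ℚ.+-monoˡ-< (ℚ.- ε) ε<1)
  δ<1 : δ < 1ℚ
  δ<1 = subst (δ <_) (ℚ.+-identityʳ 1ℚ) (ℚ.+-monoʳ-< 1ℚ (ℚ.neg-antimono-< 0<ε))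
  instance
    posQ = ℚ.positive 0<Q
    nonNegQ = ℚ.nonNegative (ℚ.<⇒≤ 0<Q)
    nonNegδ = ℚ.nonNegative (ℚ.<⇒≤ 0<δ)
  step : δ * (1ℚ + Q) ≤ Q
  step = begin
    δ * (1ℚ + Q)                          ≡⟨ solve 2 (λ ε Q → (con 1ℚ :- ε) :* (con 1ℚ :+ Q)
                                               := con 1ℚ :+ Q :- ε :* (con 1ℚ :+ Q)) refl ε Q ⟩
    1ℚ + Q - ε * (1ℚ + Q)                 ≤⟨ ℚ.+-monoʳ-≤ (1ℚ + Q) (ℚ.neg-antimono-≤ large) ⟩
    1ℚ + Q - 1ℚ                           ≡⟨ solve 1 (λ Q → con 1ℚ :+ Q :- con 1ℚ := Q) refl Q ⟩
    Q                                     ∎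

theorem1p2 : ∀ (M ε : ℚ) → 0ℚ < M → 0ℚ < ε → ε < 1ℚ →
    ∃[ m ] Σ (PermGroup (suc m)) λ G →
    Transitive G × ¬ AdmitsProductDecomposition G ×
    Σ (List (Table (suc m))) λ S → MaxIntersecting G S ×
    Σ (NonZero (length (stab G zero))) λ nz →
    let ρ = ratio (length S) (length (stab G zero)) {{nz}}
        N = (+ suc m) / 1
    in (M < ρ) × ((1ℚ - ε) * (1ℚ - ε) * N < ρ * ρ) × (ρ * ρ < N)
theorem1p2 M ε _ 0<ε ε<1 =
  _ , group , transitive , no-product-decomposition i , translations , translations-maximum , nz ,
  subst (λ ρ → M < ρ × (1ℚ - ε) * (1ℚ - ε) * ι (suc q ℕ.* q) < ρ * ρ × ρ * ρ < ι (suc q ℕ.* q))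
    (sym (ratio≡ι order-1 {{nz}} length-translations (stabiliser-order zero)))
    ( <-ι q (ℕ.≤-<-trans (ℕ.m≤m+n _ _) i<q)
    , subst (λ N → (1ℚ - ε) * (1ℚ - ε) * N < Q * Q) (sym N≡)
        (square-bound ε Q ε<1 0<ε 0<Q (subst (λ x → 1ℚ ≤ ε * x) (ι-suc q) (1≤*ι (suc q) 0<ε d≤1+q)))
    , subst₂ _<_ (ι-* q q) refl (ι-mono-< (q ℕ.* q) (suc q ℕ.* q) (ℕ.m<n+m (q ℕ.* q) {q} ℕ.z<s)) )
  where
  -- One index serves both demands, as q > i: the first summand gives M < q, the second ε (1 + q) ≥
  -- 1.
  i = ℤ.∣ ℚ.numerator M ∣ ℕ.+ ℚ.denominatorℕ ε
  open LineGroup (tower i)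
  open BinaryField (tower i) using (order-1) renaming (order to q)
  Q = ι q
  i<q : i ℕ.< q
  i<q = n<tower-order i
  nz : NonZero (length (stab group zero))
  nz = subst NonZero (sym (stabiliser-order zero)) _
  0<Q : 0ℚ < Q
  0<Q = <-ι {0ℚ} q ℕ.z<s
  d≤1+q : ℚ.denominatorℕ ε ℕ.≤ suc q
  d≤1+q = ℕ.≤-trans (ℕ.m≤n+m _ _) (ℕ.≤-trans (ℕ.<⇒≤ i<q) (ℕ.n≤1+n q))
  N≡ : ι (suc q ℕ.* q) ≡ (1ℚ + Q) * Q
  N≡ = trans (ι-* (suc q) q) (cong (_* Q) (ι-suc q))
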